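{- There exist positive constants $c$ and $d$ such that for any finite group $G$ and any subgroup $H$ of $G$, if $H$ has an $(s,t)$-data structure for some $s$ and $t$, then $G$ has an $(s+c([G:H]^2+|G|),\,2t+d)$-data structure.
   Context: Model of computation (word-RAM): data is stored in registers and memory units, each of which holds one word of $O(\log n)$ bits, where $n$ is the input size. Here the input size is the order of the group given as input. The machine can access a word and perform the usual arithmetic, logical and comparison operations on words in constant time. The elements of a group of order $n$ are taken to be $1,2,\ldots,n$, so each element fits in one word and can be accessed in constant time. Data structures have two phases. In the preprocessing phase the finite group is given by its Cayley table, and a data structure consisting of some arrays and tables is built from it. In the query phase a multiplication query consists of two group elements $g_1,g_2$ supplied by the user, and the task is to return the product $g_1g_2$ using the data structure. The time taken to answer a single query is the query-time. The space is the number of words used by the data structure. Time and space used in preprocessing are not counted. For a group $G$ and positive real numbers $s,t$, we say that $G$ has an $(s,t)$-data structure if $G$ can be stored in a data structure that uses at most $s$ space and can answer a multiplication query in time at most $t$. $[G:H]$ denotes the index of $H$ in $G$. -}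

module Defs where

open import Algebra.Bundles.Raw using (RawGroup)
open import Algebra.Core using (Op₁; Op₂)
open import Algebra.Morphism.Structures using (module GroupMorphisms)
open import Algebra.Structures using (IsGroup)
open import Data.Bool.Base using (Bool; true; false; if_then_else_; _∧_; _∨_; _xor_)
import Data.Bool.Properties as Bool
open import Data.Fin.Base using (Fin; toℕ)
open import Data.Fin.Subset using (Subset; _∈_)
open import Data.Integer.Base using (+_)
open import Data.List.Base using (List; allFin; deduplicate; drop; head; length; map)
open import Data.List.Relation.Unary.All using (All)
open import Data.Maybe.Base using (Maybe; just; nothing; _>>=_)
open import Data.Nat.Base
open import Data.Nat.DivMod using (_/_; _%_)
open import Data.Nat.ListAction using (sum)
open import Data.Nat.Logarithm using (⌊log₂_⌋)
open import Data.Nat.Properties using (m^n≢0)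
open import Data.Product.Base using (∃-syntax; _×_)
open import Data.Rational.Base as ℚ using (ℚ)
open import Data.Sum.Base using (_⊎_; inj₁; inj₂)
open import Data.Vec.Base using (lookup; tabulate)
open import Data.Vec.Properties using (≡-dec)
open import Function.Bundles using (_⇔_)
open import Level using (0ℓ)
open import Relation.Binary.PropositionalEquality.Core using (_≡_)

record FiniteGroup : Set where
  infixl 7 _∙_
  infix  8 _⁻¹
  field
    order   : ℕ
    _∙_     : Op₂ (Fin order)
    ε       : Fin order
    _⁻¹     : Op₁ (Fin order)
    isGroup : IsGroup _≡_ _∙_ ε _⁻¹

  rawGroup : RawGroup 0ℓ 0ℓ
  rawGroup = record { _≈_ = _≡_ ; _∙_ = _∙_ ; ε = ε ; _⁻¹ = _⁻¹ }

record Subgroup (G : FiniteGroup) : Set where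
  open FiniteGroup G
  field
    elements  : Subset order
    ε-closed  : ε ∈ elements
    ∙-closed  : ∀ {x y} → x ∈ elements → y ∈ elements → x ∙ y ∈ elements
    ⁻¹-closed : ∀ {x} → x ∈ elements → x ⁻¹ ∈ elements

  -- y ∈ gH exactly when g⁻¹y ∈ H.
  leftCoset : Fin order → Subset order
  leftCoset g = tabulate λ y → lookup elements (g ⁻¹ ∙ y)

  index : ℕ
  index = length (deduplicate (≡-dec Bool._≟_) (map leftCoset (allFin order)))

-- A subgroup of order k, regarded as a group in its own right, has its
-- elements renamed to Fin k; any renaming is allowed.
record Labelling {G : FiniteGroup} (H : Subgroup G) : Set where
  field
    group : FiniteGroup

  private
    module G = FiniteGroup G
    module K = FiniteGroup group
  open GroupMorphisms K.rawGroup G.rawGroup using (IsGroupMonomorphism)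

  field
    embed               : Fin K.order → Fin G.order
    isGroupMonomorphism : IsGroupMonomorphism embed
    image               : ∀ x → x ∈ Subgroup.elements H ⇔ (∃[ y ] embed y ≡ x)

bit : Bool → ℕ
bit b = if b then 1 else 0

odd : ℕ → Bool
odd a = a % 2 ≡ᵇ 1

bitwiseUpTo : (Bool → Bool → Bool) → ℕ → ℕ → ℕ → ℕ
bitwiseUpTo f zero    a b = 0
bitwiseUpTo f (suc k) a b =
  bit (f (odd a) (odd b)) + 2 * bitwiseUpTo f k ⌊ a /2⌋ ⌊ b /2⌋

-- A number has at most as many binary digits as its value, so a ⊔ b
-- positions suffice whenever f false false ≡ false.
bitwise : (Bool → Bool → Bool) → ℕ → ℕ → ℕ
bitwise f a b = bitwiseUpTo f (a ⊔ b) a b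

data Op : Set where
  add sub mul quo rem and or xor shl shr : Op

-- Subtraction is truncated; division by zero is undefined.
⟦_⟧ : Op → ℕ → ℕ → Maybe ℕ
⟦ add ⟧ a b       = just (a + b)
⟦ sub ⟧ a b       = just (a ∸ b)
⟦ mul ⟧ a b       = just (a * b)
⟦ quo ⟧ a zero    = nothing
⟦ quo ⟧ a (suc b) = just (a / suc b)
⟦ rem ⟧ a zero    = nothing
⟦ rem ⟧ a (suc b) = just (a % suc b)
⟦ and ⟧ a b       = just (bitwise _∧_ a b)
⟦ or  ⟧ a b       = just (bitwise _∨_ a b)
⟦ xor ⟧ a b       = just (bitwise _xor_ a b)
⟦ shl ⟧ a b       = just (a * 2 ^ b)
⟦ shr ⟧ a b       = just (_/_ a (2 ^ b) {{m^n≢0 2 b}})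

data Cmp : Set where
  equal less : Cmp

⟦_⟧ᶜ : Cmp → ℕ → ℕ → Bool
⟦ equal ⟧ᶜ = _≡ᵇ_
⟦ less  ⟧ᶜ = _<ᵇ_

-- Registers r, a, b, i, arrays A and jump targets l are named directly;
-- positions within an array or the working memory are held in a register i.
-- read accesses the stored arrays, load and store the working memory.
-- Register 0 holds the output on halting.
data Instr : Set where
  const  : (r v : ℕ) → Instr
  move   : (r a : ℕ) → Instr
  op     : Op → (r a b : ℕ) → Instr
  read   : (r A i : ℕ) → Instr
  load   : (r i : ℕ) → Instr
  store  : (i a : ℕ) → Instr
  jump   : (l : ℕ) → Instr
  jumpIf : Cmp → (a b l : ℕ) → Instr
  halt   : Instr

-- The arrays are produced by preprocessing and are read-only during queries.
record DataStructure : Set where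
  field
    program : List Instr
    arrays  : List (List ℕ)

  -- The query program may depend on the group, so it is stored too, one
  -- word per instruction; otherwise a multiplication table could be
  -- hidden in the program at no cost.
  space : ℕ
  space = length program + sum (map length arrays)

-- nothing = never written; reading such a cell is undefined.
Store : Set
Store = ℕ → Maybe ℕ

blank : Store
blank _ = nothing

infixl 5 _[_≔_]
_[_≔_] : Store → ℕ → ℕ → Store
(ρ [ i ≔ v ]) j = if j ≡ᵇ i then just v else ρ j

infixl 6 _‼_
_‼_ : {A : Set} → List A → ℕ → Maybe A
xs ‼ i = head (drop i xs)

record State : Set where
  constructor ⟨_,_,_⟩
  field
    pc        : ℕ
    registers : Store
    memory    : Store

-- Words are the numbers below W; a computation whose values leave this
-- range is undefined (there is no wrap-around).
module Machine (W : ℕ) (D : DataStructure) where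
  open DataStructure D

  word : ℕ → Maybe ℕ
  word v = if v <ᵇ W then just v else nothing

  exec : Instr → State → Maybe (State ⊎ ℕ)
  exec (const r v) ⟨ p , R , M ⟩ = do
    w ← word v
    just (inj₁ ⟨ suc p , R [ r ≔ w ] , M ⟩)
  exec (move r a) ⟨ p , R , M ⟩ = do
    x ← R a
    just (inj₁ ⟨ suc p , R [ r ≔ x ] , M ⟩)
  exec (op o r a b) ⟨ p , R , M ⟩ = do
    x ← R a
    y ← R b
    v ← ⟦ o ⟧ x y
    w ← word v
    just (inj₁ ⟨ suc p , R [ r ≔ w ] , M ⟩)
  exec (read r A i) ⟨ p , R , M ⟩ = do
    xs ← arrays ‼ A
    x  ← R i
    w  ← xs ‼ x
    just (inj₁ ⟨ suc p , R [ r ≔ w ] , M ⟩)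
  exec (load r i) ⟨ p , R , M ⟩ = do
    x ← R i
    w ← M x
    just (inj₁ ⟨ suc p , R [ r ≔ w ] , M ⟩)
  exec (store i a) ⟨ p , R , M ⟩ = do
    x ← R i
    w ← R a
    just (inj₁ ⟨ suc p , R , M [ x ≔ w ] ⟩)
  exec (jump l) ⟨ p , R , M ⟩ = just (inj₁ ⟨ l , R , M ⟩)
  exec (jumpIf c a b l) ⟨ p , R , M ⟩ = do
    x ← R a
    y ← R b
    just (inj₁ ⟨ if ⟦ c ⟧ᶜ x y then l else suc p , R , M ⟩)
  exec halt ⟨ p , R , M ⟩ = do
    w ← R 0
    just (inj₂ w)

  step : State → Maybe (State ⊎ ℕ)
  step σ = do
    i ← program ‼ State.pc σ
    exec i σ

  -- σ ⇓ v at k : from σ the machine outputs v after exactly k steps.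
  data _⇓_at_ : State → ℕ → ℕ → Set where
    done : ∀ {σ v} → step σ ≡ just (inj₂ v) → σ ⇓ v at 1
    next : ∀ {σ σ′ v k} → step σ ≡ just (inj₁ σ′) → σ′ ⇓ v at k → σ ⇓ v at suc k

  query : ℕ → ℕ → State
  query x y = ⟨ 0 , blank [ 0 ≔ x ] [ 1 ≔ y ] , blank ⟩

-- Words have κ times as many bits as n has binary digits.
wordBound : (κ n : ℕ) → ℕ
wordBound κ n = 2 ^ (κ * suc ⌊log₂ n ⌋)

fromℕ : ℕ → ℚ
fromℕ n = + n ℚ./ 1

-- The group elements are 1, …, n.
label : ∀ {n} → Fin n → ℕ
label g = suc (toℕ g)

record HasDataStructure (κ : ℕ) (G : FiniteGroup) (s t : ℚ) : Set where
  open FiniteGroup G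
  field
    structure : DataStructure
  open DataStructure structure public
  open Machine (wordBound κ order) structure public
  field
    words   : All (All (_< wordBound κ order)) arrays
    space≤s : fromℕ space ℚ.≤ s
    answers : ∀ g₁ g₂ → ∃[ k ] fromℕ k ℚ.≤ t ×
                (query (label g₁) (label g₂) ⇓ label (g₁ ∙ g₂) at k)

-- Write g₁ = r₁h₁ and g₂ = r₂h₂ with coset representatives rᵢ and hᵢ ∈ H. Factoring
-- x = h₁r₂ = rh′ and then y = r₁r = r′h″ gives g₁g₂ = r′ · ((h″h′)h₂). The maps
-- (h, r) ↦ hr, rh have |G| entries each by Lagrange and (r, r′) ↦ rr′ has [G:H]²,
-- so tables for them fit, and only the two products inside H remain. Both are
-- computed by the same copy of the query algorithm for H. The second call starts on
-- the registers and memory left by the first; this is harmless, because a successful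
-- run never reads a cell that it has not written.

module Submission where

open import Defs
open import Algebra.Bundles using (Group)
import Algebra.Properties.Group as GroupProperties
open import Algebra.Morphism.Structures using (module GroupMorphisms)
open import Algebra.Structures using (module IsGroup)
open import Data.Bool.Base using (true; false; T; if_then_else_)
import Data.Bool.Properties as Bool
open import Data.Fin.Base using (Fin; zero; suc; toℕ; combine; remQuot)
open import Data.Fin.Properties
  using (toℕ<n; toℕ-combine; remQuot-combine; combine-remQuot; injective⇒≤)
open import Data.Fin.Subset using (Subset; _∈_)
import Data.Integer.Base as ℤ
import Data.Integer.Properties as ℤ
open import Data.List.Base
  using (List; []; _∷_; _++_; allFin; deduplicate; length; map; tabulate)
import Data.List.Base as List
open import Data.List.Membership.Propositional using () renaming (_∈_ to _∈ₗ_)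
open import Data.List.Membership.Propositional.Properties
  using (∈-allFin; ∈-deduplicate⁺; ∈-deduplicate⁻; ∈-lookup; ∈-map⁺; ∈-map⁻)
open import Data.List.Properties using (length-map; length-tabulate; map-++)
open import Data.List.Relation.Unary.All as All using (All; []; _∷_)
open import Data.List.Relation.Unary.All.Properties using (++⁺; tabulate⁺)
open import Data.List.Relation.Unary.AllPairs using (_∷_)
open import Data.List.Relation.Unary.Any using () renaming (index to position)
open import Data.List.Relation.Unary.Any.Properties using (lookup-index)
open import Data.List.Relation.Unary.Unique.Propositional using (Unique)
open import Data.List.Relation.Unary.Unique.DecPropositional.Properties using (deduplicate-!)
open import Data.Maybe.Base using (Maybe; just; _>>=_)
open import Data.Nat.Base
  using (ℕ; zero; suc; _≤_; _<_; _+_; _*_; _^_; _≡ᵇ_; _<ᵇ_; z≤n; s≤s; >-nonZero)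
open import Data.Nat.ListAction using (sum)
open import Data.Nat.ListAction.Properties using (sum-++)
open import Data.Nat.Logarithm using (⌊log₂_⌋; ⌊log₂⌋-mono-≤; ⌊log₂[2^n]⌋≡n)
import Data.Nat.Properties as ℕ
open import Data.Nat.Solver using (module +-*-Solver)
open import Data.Product.Base using (∃-syntax; ∃₂; _×_; _,_; proj₁; proj₂; uncurry)
open import Data.Rational.Base as ℚ using (ℚ; Positive)
import Data.Rational.Properties as ℚ
open import Data.Rational.Unnormalised.Base as ℚᵘ using (mkℚᵘ; *≡*; *≤*)
import Data.Rational.Unnormalised.Properties as ℚᵘ
open import Data.Sum.Base using (inj₁; inj₂)
open import Data.Vec.Base using (lookup)
open import Data.Vec.Properties
  using (≡-dec; lookup∘tabulate; tabulate-cong; []=⇒lookup; lookup⇒[]=)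
open import Function.Base using (_∘_)
open import Function.Bundles using (mk⇔; module Equivalence)
open import Relation.Binary.PropositionalEquality
  using (_≡_; refl; sym; trans; cong; cong₂; subst; module ≡-Reasoning)
open import Relation.Nullary.Negation using (contradiction)

-- Word sizes

-- Otherwise monotonicity of `⌊log₂_⌋` would bound the exponent `suc ⌊log₂ n ⌋` by `⌊log₂ n ⌋`.
n<2^[1+⌊log₂n⌋] : ∀ n → n < 2 ^ suc ⌊log₂ n ⌋
n<2^[1+⌊log₂n⌋] n = ℕ.≰⇒> λ 2^≤n →
  ℕ.1+n≰n (subst (_≤ ⌊log₂ n ⌋) (⌊log₂[2^n]⌋≡n (suc ⌊log₂ n ⌋)) (⌊log₂⌋-mono-≤ 2^≤n))

-- A subgroup has at most the order of `G`, so words that are legal for `H` stay legal on the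
-- machine for `G`.
wordBound-mono : ∀ κ {m n} → m ≤ n → wordBound κ m ≤ wordBound κ n
wordBound-mono κ m≤n = ℕ.^-monoʳ-≤ 2 (ℕ.*-monoʳ-≤ κ (s≤s (⌊log₂⌋-mono-≤ m≤n)))

-- The assumption `2 ≤ κ` enters here: `n` fits into `e` bits, hence `n * n` into twice as many.
-- Every position in the tables for `G` is at most the square of its order.
n*n<wordBound : ∀ {κ} → 2 ≤ κ → ∀ n → n * n < wordBound κ n
n*n<wordBound {κ} 2≤κ n = begin-strict
  n * n                    <⟨ ℕ.*-mono-< n<2^e n<2^e ⟩
  2 ^ e * 2 ^ e            ≡⟨ ℕ.^-distribˡ-+-* 2 e e ⟨
  2 ^ (e + e)              ≡⟨ cong (λ x → 2 ^ (e + x)) (ℕ.+-identityʳ e) ⟨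
  2 ^ (2 * e)              ≤⟨ ℕ.^-monoʳ-≤ 2 (ℕ.*-monoˡ-≤ e 2≤κ) ⟩
  wordBound κ n            ∎
  where
  open ℕ.≤-Reasoning
  e = suc ⌊log₂ n ⌋
  n<2^e = n<2^[1+⌊log₂n⌋] n

-- Naturals in ℚ

-- `fromℕ` normalises its fraction and so does not compute on a variable. Among unnormalised
-- rationals the denominator is literally 1 (stored as 0), which reduces the next three facts to
-- integer arithmetic.
toℚᵘ-fromℕ : ∀ n → ℚ.toℚᵘ (fromℕ n) ℚᵘ.≃ mkℚᵘ (ℤ.+ n) 0
toℚᵘ-fromℕ n = ℚ.toℚᵘ-fromℚᵘ (mkℚᵘ (ℤ.+ n) 0)

fromℕ-mono-≤ : ∀ {m n} → m ≤ n → fromℕ m ℚ.≤ fromℕ n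
fromℕ-mono-≤ {m} {n} m≤n = ℚ.toℚᵘ-cancel-≤
  (ℚᵘ.≤-respˡ-≃ (ℚᵘ.≃-sym (toℚᵘ-fromℕ m)) (ℚᵘ.≤-respʳ-≃ (ℚᵘ.≃-sym (toℚᵘ-fromℕ n))
    (*≤* (ℤ.*-monoʳ-≤-nonNeg (ℤ.+ 1) (ℤ.+≤+ m≤n)))))

fromℕ-homo-+ : ∀ m n → fromℕ (m + n) ≡ fromℕ m ℚ.+ fromℕ n
fromℕ-homo-+ m n = ℚ.toℚᵘ-injective (begin
  ℚ.toℚᵘ (fromℕ (m + n))                      ≈⟨ toℚᵘ-fromℕ (m + n) ⟩
  mkℚᵘ (ℤ.+ (m + n)) 0                        ≈⟨ *≡* (cong (ℤ._* ℤ.+ 1) (sym (cong₂ ℤ._+_ (ℤ.*-identityʳ (ℤ.+ m)) (ℤ.*-identityʳ (ℤ.+ n))))) ⟩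
  mkℚᵘ (ℤ.+ m) 0 ℚᵘ.+ mkℚᵘ (ℤ.+ n) 0          ≈⟨ ℚᵘ.+-cong (toℚᵘ-fromℕ m) (toℚᵘ-fromℕ n) ⟨
  ℚ.toℚᵘ (fromℕ m) ℚᵘ.+ ℚ.toℚᵘ (fromℕ n)      ≈⟨ ℚ.toℚᵘ-homo-+ (fromℕ m) (fromℕ n) ⟨
  ℚ.toℚᵘ (fromℕ m ℚ.+ fromℕ n)                ∎)
  where open ℚᵘ.≃-Reasoning

fromℕ-homo-* : ∀ m n → fromℕ (m * n) ≡ fromℕ m ℚ.* fromℕ n
fromℕ-homo-* m n = ℚ.toℚᵘ-injective (begin
  ℚ.toℚᵘ (fromℕ (m * n))                      ≈⟨ toℚᵘ-fromℕ (m * n) ⟩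
  mkℚᵘ (ℤ.+ (m * n)) 0                        ≈⟨ *≡* (cong (ℤ._* ℤ.+ 1) (ℤ.pos-* m n)) ⟩
  mkℚᵘ (ℤ.+ m) 0 ℚᵘ.* mkℚᵘ (ℤ.+ n) 0          ≈⟨ ℚᵘ.*-cong (toℚᵘ-fromℕ m) (toℚᵘ-fromℕ n) ⟨
  ℚ.toℚᵘ (fromℕ m) ℚᵘ.* ℚ.toℚᵘ (fromℕ n)      ≈⟨ ℚ.toℚᵘ-homo-* (fromℕ m) (fromℕ n) ⟨
  ℚ.toℚᵘ (fromℕ m ℚ.* fromℕ n)                ∎)
  where open ℚᵘ.≃-Reasoning

-- Cosets

Unique⇒lookup-injective : ∀ {A : Set} {xs : List A} → Unique xs →
  ∀ {i j} → List.lookup xs i ≡ List.lookup xs j → i ≡ j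
Unique⇒lookup-injective (x∉xs ∷ u) {zero}  {zero}  eq = refl
Unique⇒lookup-injective (x∉xs ∷ u) {zero}  {suc j} eq =
  contradiction eq (All.lookup x∉xs (∈-lookup j))
Unique⇒lookup-injective (x∉xs ∷ u) {suc i} {zero}  eq =
  contradiction (sym eq) (All.lookup x∉xs (∈-lookup i))
Unique⇒lookup-injective (x∉xs ∷ u) {suc i} {suc j} eq =
  cong suc (Unique⇒lookup-injective u eq)

toGroup : FiniteGroup → Group _ _
toGroup G = record { isGroup = FiniteGroup.isGroup G }

module Cosets {G : FiniteGroup} {H : Subgroup G} (L : Labelling H) where
  open FiniteGroup G
  open IsGroup isGroup using (assoc; inverseˡ)
  open GroupProperties (toGroup G)
    using (∙-cancelˡ; ⁻¹-anti-homo-∙; \\-leftDividesˡ; \\-leftDividesʳ)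
  open Subgroup H
  open Labelling L public using (embed)
  open Labelling L using (group; isGroupMonomorphism; image)
  module K = FiniteGroup group
  open GroupMorphisms K.rawGroup rawGroup
  open IsGroupMonomorphism isGroupMonomorphism public using () renaming (injective to embed-injective; ∙-homo to embed-homo)

  cosets : List (Subset order)
  cosets = deduplicate (≡-dec Bool._≟_) (map leftCoset (allFin order))

  leftCoset∈cosets : ∀ g → leftCoset g ∈ₗ cosets
  leftCoset∈cosets g = ∈-deduplicate⁺ (≡-dec Bool._≟_) (∈-map⁺ leftCoset (∈-allFin g))

  abstract
    coset : Fin order → Fin index
    coset g = position (leftCoset∈cosets g)

    representative : ∀ i → ∃[ g ] List.lookup cosets i ≡ leftCoset g
    representative i with ∈-map⁻ leftCoset (∈-deduplicate⁻ (≡-dec Bool._≟_) _ (∈-lookup {xs = cosets} i))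
    ... | g , _ , eq = g , eq

  rep : Fin index → Fin order
  rep i = proj₁ (representative i)

  lookup-leftCoset : ∀ g y → lookup (leftCoset g) y ≡ lookup elements (g ⁻¹ ∙ y)
  lookup-leftCoset g = lookup∘tabulate _

  abstract
    leftCoset-rep-coset : ∀ g → leftCoset (rep (coset g)) ≡ leftCoset g
    leftCoset-rep-coset g = trans (sym (proj₂ (representative (coset g)))) (sym (lookup-index (leftCoset∈cosets g)))

  -- As `ε` is in H, `g` lies in its own coset, which as a subset equals the coset of its
  -- representative.
  rep⁻¹∙∈H : ∀ g → rep (coset g) ⁻¹ ∙ g ∈ elements
  rep⁻¹∙∈H g = lookup⇒[]= _ elements (begin
    lookup elements (rep (coset g) ⁻¹ ∙ g)  ≡⟨ lookup-leftCoset (rep (coset g)) g ⟨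
    lookup (leftCoset (rep (coset g))) g    ≡⟨ cong (λ S → lookup S g) (leftCoset-rep-coset g) ⟩
    lookup (leftCoset g) g                  ≡⟨ lookup-leftCoset g g ⟩
    lookup elements (g ⁻¹ ∙ g)              ≡⟨ cong (lookup elements) (inverseˡ g) ⟩
    lookup elements ε                       ≡⟨ []=⇒lookup ε-closed ⟩
    true                                    ∎)
    where open ≡-Reasoning

  abstract
    part : Fin order → Fin K.order
    part g = proj₁ (Equivalence.to (image _) (rep⁻¹∙∈H g))

    rep∙part : ∀ g → rep (coset g) ∙ embed (part g) ≡ g
    rep∙part g = trans (cong (rep (coset g) ∙_) (proj₂ (Equivalence.to (image _) (rep⁻¹∙∈H g))))
                       (\\-leftDividesˡ (rep (coset g)) g)

  embed∈H : ∀ h → embed h ∈ elements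
  embed∈H h = Equivalence.from (image _) (h , refl)

  -- One direction multiplies by `h ⁻¹` on the left, the other by `h`.
  lookup-∈-∙ : ∀ {h} z → h ∈ elements → lookup elements (h ∙ z) ≡ lookup elements z
  lookup-∈-∙ {h} z h∈H = Bool.⇔→≡ {z = true} (mk⇔
    (λ hz∈H → []=⇒lookup (subst (_∈ elements) (\\-leftDividesʳ h z)
                (∙-closed (⁻¹-closed h∈H) (lookup⇒[]= _ elements hz∈H))))
    (λ z∈H → []=⇒lookup (∙-closed h∈H (lookup⇒[]= _ elements z∈H))))

  leftCoset-∙-∈ : ∀ g {h} → h ∈ elements → leftCoset (g ∙ h) ≡ leftCoset g
  leftCoset-∙-∈ g {h} h∈H = tabulate-cong λ y → begin
    lookup elements ((g ∙ h) ⁻¹ ∙ y)     ≡⟨ cong (λ x → lookup elements (x ∙ y)) (⁻¹-anti-homo-∙ g h) ⟩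
    lookup elements (h ⁻¹ ∙ g ⁻¹ ∙ y)    ≡⟨ cong (lookup elements) (assoc _ _ _) ⟩
    lookup elements (h ⁻¹ ∙ (g ⁻¹ ∙ y))  ≡⟨ lookup-∈-∙ _ (⁻¹-closed h∈H) ⟩
    lookup elements (g ⁻¹ ∙ y)           ∎
    where open ≡-Reasoning

  -- Both products lie in a single coset, and `cosets` has no duplicates, so the positions agree;
  -- the common representative then cancels.
  rep∙embed-injective : ∀ {i j h h′} → rep i ∙ embed h ≡ rep j ∙ embed h′ → i ≡ j × h ≡ h′
  rep∙embed-injective {i} {j} {h} {h′} eq
    = i≡j , embed-injective (∙-cancelˡ (rep i) _ _
        (trans eq (cong (λ l → rep l ∙ embed h′) (sym i≡j))))
    where
    open ≡-Reasoning
    i≡j : i ≡ j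
    i≡j = Unique⇒lookup-injective (deduplicate-! (≡-dec Bool._≟_) (map leftCoset (allFin order))) (begin
      List.lookup cosets i          ≡⟨ proj₂ (representative i) ⟩
      leftCoset (rep i)             ≡⟨ leftCoset-∙-∈ (rep i) (embed∈H h) ⟨
      leftCoset (rep i ∙ embed h)   ≡⟨ cong leftCoset eq ⟩
      leftCoset (rep j ∙ embed h′)  ≡⟨ leftCoset-∙-∈ (rep j) (embed∈H h′) ⟩
      leftCoset (rep j)             ≡⟨ proj₂ (representative j) ⟨
      List.lookup cosets j          ∎)

  -- The half of Lagrange's theorem that bounds the tables: coset number and H-part, packed into one
  -- index, inject into `G`.
  index*order≤order : index * K.order ≤ order
  index*order≤order = injective⇒≤ {f = λ x → let i , h = remQuot {index} K.order x in rep i ∙ embed h}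
    λ {x} {y} eq → let i≡j , h≡h′ = rep∙embed-injective eq in begin
      x                                                 ≡⟨ combine-remQuot {index} K.order x ⟨
      uncurry combine (remQuot {index} K.order x)       ≡⟨ cong₂ combine i≡j h≡h′ ⟩
      uncurry combine (remQuot {index} K.order y)       ≡⟨ combine-remQuot {index} K.order y ⟩
      y                                                 ∎
    where open ≡-Reasoning

-- The machine

-- Each clause of `exec` is a chain of partial accesses; a successful step is taken apart into its
-- successful accesses with this, and `_⟫_` puts a step together again.
just-bind : ∀ {A B : Set} (m : Maybe A) {f : A → Maybe B} {y} →
  (m >>= f) ≡ just y → ∃[ x ] m ≡ just x × f x ≡ just y
just-bind (just x) eq = x , refl , eq

infixr 5 _⟫_
_⟫_ : ∀ {A B : Set} {m : Maybe A} {f : A → Maybe B} {x y} →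
  m ≡ just x → f x ≡ y → (m >>= f) ≡ y
refl ⟫ eq = eq

infix 4 _⊑_
-- The right store may hold leftovers where the left one is unwritten. Successful runs cannot tell,
-- since reading an unwritten cell is undefined.
_⊑_ : Store → Store → Set
R ⊑ R′ = ∀ i {v} → R i ≡ just v → R′ i ≡ just v

⊑-update : ∀ {R R′} i v → R ⊑ R′ → R [ i ≔ v ] ⊑ R′ [ i ≔ v ]
⊑-update i v R⊑R′ j eq with j ≡ᵇ i
... | true  = eq
... | false = R⊑R′ j eq

module Steps (W : ℕ) (D : DataStructure) where
  open DataStructure D
  open Machine W D

  word-< : ∀ {v} → v < W → word v ≡ just v
  word-< {v} v<W with v <ᵇ W | ℕ.<⇒<ᵇ v<W
  ... | true | _ = refl

  word⁻ : ∀ v {w} → word v ≡ just w → v < W × v ≡ w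
  word⁻ v eq with v <ᵇ W in v<ᵇW
  word⁻ v refl | true = ℕ.<ᵇ⇒< v W (subst T (sym v<ᵇW) _) , refl

  -- A data type instead of the bare equation, so that unification recovers both states from the
  -- type.
  data _⟶_ (σ τ : State) : Set where
    by : step σ ≡ just (inj₁ τ) → σ ⟶ τ

  infixr 0 _then_
  _then_ : ∀ {σ τ v k} → σ ⟶ τ → τ ⇓ v at k → σ ⇓ v at suc k
  by eq then rest = next eq rest

  step-read : ∀ {p R M r A i xs x w} → program ‼ p ≡ just (read r A i) →
    arrays ‼ A ≡ just xs → R i ≡ just x → xs ‼ x ≡ just w →
    ⟨ p , R , M ⟩ ⟶ ⟨ suc p , R [ r ≔ w ] , M ⟩
  step-read instr array reg entry = by (instr ⟫ array ⟫ reg ⟫ entry ⟫ refl)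

  step-op : ∀ {p R M o r a b x y v} → program ‼ p ≡ just (op o r a b) →
    R a ≡ just x → R b ≡ just y → ⟦ o ⟧ x y ≡ just v → v < W →
    ⟨ p , R , M ⟩ ⟶ ⟨ suc p , R [ r ≔ v ] , M ⟩
  step-op instr regˡ regʳ value v<W =
    by (instr ⟫ regˡ ⟫ regʳ ⟫ value ⟫ word-< v<W ⟫ refl)

  step-const : ∀ {p R M r v} → program ‼ p ≡ just (const r v) → v < W →
    ⟨ p , R , M ⟩ ⟶ ⟨ suc p , R [ r ≔ v ] , M ⟩
  step-const instr v<W = by (instr ⟫ word-< v<W ⟫ refl)

  step-move : ∀ {p R M r a x} → program ‼ p ≡ just (move r a) → R a ≡ just x →
    ⟨ p , R , M ⟩ ⟶ ⟨ suc p , R [ r ≔ x ] , M ⟩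
  step-move instr reg = by (instr ⟫ reg ⟫ refl)

  step-load : ∀ {p R M r i x w} → program ‼ p ≡ just (load r i) →
    R i ≡ just x → M x ≡ just w →
    ⟨ p , R , M ⟩ ⟶ ⟨ suc p , R [ r ≔ w ] , M ⟩
  step-load instr reg cell = by (instr ⟫ reg ⟫ cell ⟫ refl)

  step-store : ∀ {p R M i a x w} → program ‼ p ≡ just (store i a) →
    R i ≡ just x → R a ≡ just w →
    ⟨ p , R , M ⟩ ⟶ ⟨ suc p , R , M [ x ≔ w ] ⟩
  step-store instr regˡ regʳ = by (instr ⟫ regˡ ⟫ regʳ ⟫ refl)

  step-jump : ∀ {p R M l} → program ‼ p ≡ just (jump l) →
    ⟨ p , R , M ⟩ ⟶ ⟨ l , R , M ⟩
  step-jump instr = by (instr ⟫ refl)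

  step-jumpIf : ∀ {p R M c a b l x y} t → program ‼ p ≡ just (jumpIf c a b l) →
    R a ≡ just x → R b ≡ just y → ⟦ c ⟧ᶜ x y ≡ t →
    ⟨ p , R , M ⟩ ⟶ ⟨ if t then l else suc p , R , M ⟩
  step-jumpIf t instr regˡ regʳ refl = by (instr ⟫ regˡ ⟫ regʳ ⟫ refl)

map-‼ : ∀ {A B : Set} (f : A → B) xs i {x} → xs ‼ i ≡ just x → map f xs ‼ i ≡ just (f x)
map-‼ f (x ∷ xs) zero    refl = refl
map-‼ f (x ∷ xs) (suc i) eq   = map-‼ f xs i eq

-- Relocation and simulation of the query algorithm for `H`

-- The query algorithm for H runs as a subroutine: its registers and arrays are
-- numbered after those of the caller, and instead of halting it jumps to the
-- return address.
#registers #arrays entry return : ℕ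
#registers = 7
#arrays    = 7
entry      = 21
return     = 14

relocate : Instr → Instr
relocate (const r v)      = const (#registers + r) v
relocate (move r a)       = move (#registers + r) (#registers + a)
relocate (op o r a b)     = op o (#registers + r) (#registers + a) (#registers + b)
relocate (read r A i)     = read (#registers + r) (#arrays + A) (#registers + i)
relocate (load r i)       = load (#registers + r) (#registers + i)
relocate (store i a)      = store (#registers + i) (#registers + a)
relocate (jump l)         = jump (entry + l)
relocate (jumpIf c a b l) = jumpIf c (#registers + a) (#registers + b) (entry + l)
relocate halt             = jump return

infix 4 _≈_
-- The frame condition: a call preserves the caller's registers. With the boolean bound, `_` proves
-- it for each concrete register.
_≈_ : Store → Store → Set
R ≈ Q = ∀ i → T (i <ᵇ #registers) → R i ≡ Q i

<ᵇ⇒≢ᵇ+ : ∀ i m r → T (i <ᵇ m) → (i ≡ᵇ m + r) ≡ false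
<ᵇ⇒≢ᵇ+ zero    (suc m) r _   = refl
<ᵇ⇒≢ᵇ+ (suc i) (suc m) r i<m = <ᵇ⇒≢ᵇ+ i m r i<m

≈-update : ∀ {R Q} r v → R ≈ Q → R [ #registers + r ≔ v ] ≈ Q
≈-update r v R≈Q i i<7 rewrite <ᵇ⇒≢ᵇ+ i #registers r i<7 = R≈Q i i<7

module Subroutine
  {W W′ : ℕ} (W≤W′ : W ≤ W′) (D D′ : DataStructure)
  (fetch : ∀ p {i} → DataStructure.program D ‼ p ≡ just i →
           DataStructure.program D′ ‼ (entry + p) ≡ just (relocate i))
  (arrays-shift : ∀ A {xs} → DataStructure.arrays D ‼ A ≡ just xs →
                  DataStructure.arrays D′ ‼ (#arrays + A) ≡ just xs)
  where
  open DataStructure D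
  private
    module M  = Machine W D
    module M′ = Machine W′ D′
  open Steps W D using (word⁻)
  open Steps W′ D′ hiding (word⁻)

  -- Memory addresses are not shifted, because the caller never touches the working memory. `Q`
  -- records the caller's registers at the time of the call.
  data Simulates (Q : Store) : State → State → Set where
    simulates : ∀ {p R R′ M M′} → R ⊑ R′ ∘ (#registers +_) → M ⊑ M′ → R′ ≈ Q →
      Simulates Q ⟨ p , R , M ⟩ ⟨ entry + p , R′ , M′ ⟩

  -- Every access that succeeds for `D` finds the same value in the larger stores, and a result
  -- below `W` is also below `W′`.
  exec-simulates : ∀ {Q τ σ′} i {p R M} → program ‼ p ≡ just i →
    Simulates Q ⟨ p , R , M ⟩ τ → M.exec i ⟨ p , R , M ⟩ ≡ just (inj₁ σ′) →
    ∃[ τ′ ] τ ⟶ τ′ × Simulates Q σ′ τ′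
  exec-simulates (const r v) {p} e (simulates s m f) eq
    with w , word≡ , refl ← just-bind (M.word v) eq
    with v<W , refl ← word⁻ v word≡ =
    _ , step-const (fetch p e) (ℕ.<-≤-trans v<W W≤W′) ,
    simulates (⊑-update r v s) m (≈-update r v f)
  exec-simulates (move r a) {p} {R} e (simulates s m f) eq
    with x , Ra , refl ← just-bind (R a) eq =
    _ , step-move (fetch p e) (s a Ra) ,
    simulates (⊑-update r x s) m (≈-update r x f)
  exec-simulates (op o r a b) {p} {R} e (simulates s m f) eq
    with x , Ra , eq ← just-bind (R a) eq
    with y , Rb , eq ← just-bind (R b) eq
    with v , value , eq ← just-bind (⟦ o ⟧ x y) eq
    with w , word≡ , refl ← just-bind (M.word v) eq
    with v<W , refl ← word⁻ v word≡ =
    _ , step-op (fetch p e) (s a Ra) (s b Rb) value (ℕ.<-≤-trans v<W W≤W′) ,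
    simulates (⊑-update r v s) m (≈-update r v f)
  exec-simulates (read r A i) {p} {R} e (simulates s m f) eq
    with xs , array , eq ← just-bind (arrays ‼ A) eq
    with x , Ri , eq ← just-bind (R i) eq
    with w , cell , refl ← just-bind (xs ‼ x) eq =
    _ , step-read (fetch p e) (arrays-shift A array) (s i Ri) cell ,
    simulates (⊑-update r w s) m (≈-update r w f)
  exec-simulates (load r i) {p} {R} {M} e (simulates s m f) eq
    with x , Ri , eq ← just-bind (R i) eq
    with w , cell , refl ← just-bind (M x) eq =
    _ , step-load (fetch p e) (s i Ri) (m x cell) ,
    simulates (⊑-update r w s) m (≈-update r w f)
  exec-simulates (store i a) {p} {R} e (simulates s m f) eq
    with x , Ri , eq ← just-bind (R i) eq
    with w , Ra , refl ← just-bind (R a) eq =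
    _ , step-store (fetch p e) (s i Ri) (s a Ra) ,
    simulates s (⊑-update x w m) f
  exec-simulates (jump l) {p} e (simulates s m f) refl =
    _ , step-jump (fetch p e) , simulates s m f
  exec-simulates (jumpIf c a b l) {p} {R} e (simulates s m f) eq
    with x , Ra , eq ← just-bind (R a) eq
    with y , Rb , refl ← just-bind (R b) eq
    -- Only for a known truth value is the new address visibly `entry` plus the old one.
    with ⟦ c ⟧ᶜ x y | step-jumpIf (⟦ c ⟧ᶜ x y) (fetch p e) (s a Ra) (s b Rb) refl
  ... | true  | τ⟶τ′ = _ , τ⟶τ′ , simulates s m f
  ... | false | τ⟶τ′ = _ , τ⟶τ′ , simulates s m f
  exec-simulates halt {R = R} _ _ eq with _ , _ , () ← just-bind (R 0) eq

  exec-halts : ∀ i {σ w} → M.exec i σ ≡ just (inj₂ w) →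
    i ≡ halt × State.registers σ 0 ≡ just w
  exec-halts (const r v) eq with _ , _ , () ← just-bind (M.word v) eq
  exec-halts (move r a) {σ} eq with _ , _ , () ← just-bind (State.registers σ a) eq
  exec-halts (op o r a b) {σ} eq
    with x , _ , eq ← just-bind (State.registers σ a) eq
    with y , _ , eq ← just-bind (State.registers σ b) eq
    with v , _ , eq ← just-bind (⟦ o ⟧ x y) eq
    with _ , _ , () ← just-bind (M.word v) eq
  exec-halts (read r A i) {σ} eq
    with xs , _ , eq ← just-bind (arrays ‼ A) eq
    with x , _ , eq ← just-bind (State.registers σ i) eq
    with _ , _ , () ← just-bind (xs ‼ x) eq
  exec-halts (load r i) {σ} eq
    with x , _ , eq ← just-bind (State.registers σ i) eq
    with _ , _ , () ← just-bind (State.memory σ x) eq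
  exec-halts (store i a) {σ} eq
    with x , _ , eq ← just-bind (State.registers σ i) eq
    with _ , _ , () ← just-bind (State.registers σ a) eq
  exec-halts (jumpIf c a b l) {σ} eq
    with x , _ , eq ← just-bind (State.registers σ a) eq
    with _ , _ , () ← just-bind (State.registers σ b) eq
  exec-halts halt {σ} eq with _ , R0 , refl ← just-bind (State.registers σ 0) eq = refl , R0

  -- What the caller does after the call. It must work for all leftovers of the subroutine; only the
  -- frame and the output, register 0 shifted to `#registers`, are known.
  Returns : Store → ℕ → ℕ → ℕ → Set
  Returns Q w v j = ∀ R M → R ≈ Q → R #registers ≡ just w → ⟨ return , R , M ⟩ M′.⇓ v at j

  -- Step counts match exactly: the final `halt` costs one step, as does the jump replacing it.
  run-simulates : ∀ {Q σ τ w k v j} → σ M.⇓ w at k → Simulates Q σ τ →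
    Returns Q w v j → τ M′.⇓ v at (k + j)
  run-simulates {σ = σ} (M.done eq) (simulates {p} s m f) continue
    with i , e , eq ← just-bind (program ‼ p) eq
    with refl , R0 ← exec-halts i eq =
    step-jump (fetch p e) then continue _ _ f (s 0 R0)
  run-simulates {σ = σ} (M.next eq rest) sim@(simulates {p} _ _ _) continue
    with i , e , eq ← just-bind (program ‼ p) eq
    with τ′ , τ⟶τ′ , sim′ ← exec-simulates i e sim eq =
    τ⟶τ′ then run-simulates rest sim′ continue

  -- A fresh query has only registers 0 and 1 written and blank memory, so any `R` and `M` with the
  -- two arguments in place lie above it, including those left by an earlier call.
  call : ∀ {R M x y w k v j} → M.query x y M.⇓ w at k →
    R #registers ≡ just x → R (suc #registers) ≡ just y →
    Returns R w v j → ⟨ entry , R , M ⟩ M′.⇓ v at (k + j)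
  call run Rx Ry = run-simulates run
    (simulates (λ { 0 refl → Rx ; 1 refl → Ry }) (λ _ ()) (λ _ _ → refl))

-- Tables

-- Labels start at 1, so cell 0 of each table is a dummy.
byLabel : ∀ {n} → (Fin n → ℕ) → List ℕ
byLabel f = 0 ∷ tabulate f

grid : ∀ {m n} → (Fin m → Fin n → ℕ) → List ℕ
grid {m} {n} f = byLabel (uncurry f ∘ remQuot {m} n)

tabulate-‼ : ∀ {n} (f : Fin n → ℕ) i → tabulate f ‼ toℕ i ≡ just (f i)
tabulate-‼ f zero    = refl
tabulate-‼ f (suc i) = tabulate-‼ (f ∘ suc) i

byLabel-‼ : ∀ {n} (f : Fin n → ℕ) i → byLabel f ‼ label i ≡ just (f i)
byLabel-‼ = tabulate-‼

-- The dummy cell lets the column enter as a label, so a stored row offset plus a label is the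
-- position.
label-combine : ∀ {m n} (i : Fin m) (j : Fin n) → label (combine i j) ≡ n * toℕ i + label j
label-combine {n = n} i j = trans (cong suc (toℕ-combine i j)) (sym (ℕ.+-suc (n * toℕ i) (toℕ j)))

grid-‼ : ∀ {m n} (f : Fin m → Fin n → ℕ) i j → grid f ‼ (n * toℕ i + label j) ≡ just (f i j)
grid-‼ {m} {n} f i j = begin
  grid f ‼ (n * toℕ i + label j)             ≡⟨ cong (grid {m} f ‼_) (label-combine i j) ⟨
  grid f ‼ label (combine i j)               ≡⟨ byLabel-‼ _ (combine i j) ⟩
  just (uncurry f (remQuot n (combine i j))) ≡⟨ cong (just ∘ uncurry f) (remQuot-combine i j) ⟩
  just (f i j)                               ∎
  where open ≡-Reasoning

label≤ : ∀ {n} (i : Fin n) → label i ≤ n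
label≤ = toℕ<n

grid-index≤ : ∀ {m n} (i : Fin m) (j : Fin n) → n * toℕ i + label j ≤ m * n
grid-index≤ {m} {n} i j = subst (_≤ m * n) (label-combine i j) (label≤ (combine i j))

grid-row≤ : ∀ {m n} (i : Fin m) → n * toℕ i ≤ m * n
grid-row≤ {m} {n} i = begin
  n * toℕ i  ≤⟨ ℕ.*-monoʳ-≤ n (ℕ.<⇒≤ (toℕ<n i)) ⟩
  n * m      ≡⟨ ℕ.*-comm n m ⟩
  m * n      ∎
  where open ℕ.≤-Reasoning

length-byLabel : ∀ {n} (f : Fin n → ℕ) → length (byLabel f) ≡ suc n
length-byLabel f = cong suc (length-tabulate f)

length-grid : ∀ {m n} (f : Fin m → Fin n → ℕ) → length (grid f) ≡ suc (m * n)
length-grid {m} {n} f = length-byLabel (uncurry f ∘ remQuot {m} n)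

byLabel-All : ∀ {n W} {f : Fin n → ℕ} → 0 < W → (∀ i → f i < W) → All (_< W) (byLabel f)
byLabel-All 0<W f<W = 0<W ∷ tabulate⁺ f<W

-- The data structure for `G`: arrays, program, space and run

-- For representatives r_i: g ∈ r_(coset g) H, and part g is the remaining factor in H;
-- swap j h = h r_j, times i j = r_i r_j and join i h = r_i h.
module Caller {n m k : ℕ} (coset : Fin n → Fin m) (part : Fin n → Fin k)
  (swap : Fin m → Fin k → Fin n) (times : Fin m → Fin m → Fin n) (join : Fin m → Fin k → Fin n)
  (D : DataStructure) where
  open DataStructure D

  -- Arrays 1 and 2 hold row offsets instead of coset numbers: multiples of `k` for `swap` and
  -- `join`, whose rows have `k` entries, and multiples of `m` for `times`.
  callerArrays : List (List ℕ)
  callerArrays =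
    byLabel (label ∘ part) ∷
    byLabel (λ g → k * toℕ (coset g)) ∷
    byLabel (λ g → m * toℕ (coset g)) ∷
    byLabel (label ∘ coset) ∷
    grid (λ j h → label (swap j h)) ∷
    grid (λ i j → label (times i j)) ∷
    grid (λ i h → label (join i h)) ∷
    []

  -- In the notation of the header, r₁, r₂, r, r′ represent the cosets numbered i, j, l, q.
  -- Register 6 is 0 when the subroutine returns for the first time and equals
  -- label h₂ > 0 when it returns for the second time.
  caller : List Instr
  caller =
    read 2 0 0 ∷                 -- h₁
    read 3 2 0 ∷                 -- m i
    read 4 0 1 ∷                 -- h₂
    read 5 1 1 ∷                 -- k j
    op add 5 5 2 ∷
    read 5 4 5 ∷                 -- x = h₁r₂
    read 6 3 5 ∷                 -- l
    op add 3 3 6 ∷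
    read 3 5 3 ∷                 -- y = r₁r
    read 2 1 3 ∷                 -- k q
    read #registers 0 3 ∷        -- h″
    read (suc #registers) 0 5 ∷  -- h′
    const 6 0 ∷
    jump entry ∷
    jumpIf equal 6 4 18 ∷        -- return address 14
    move 6 4 ∷
    move (suc #registers) 4 ∷
    jump entry ∷
    op add 2 2 #registers ∷
    read 0 6 2 ∷                 -- r′((h″h′)h₂)
    halt ∷
    []

  -- There are 21 instructions in `caller` and 7 arrays in `callerArrays`, whence `entry` and
  -- `#arrays`: lookups past them reduce by computation to lookups in the parts coming from `D`.
  extended : DataStructure
  extended = record
    { program = caller ++ map relocate program
    ; arrays  = callerArrays ++ arrays
    }

  length-callerArrays : sum (map length callerArrays) ≡
    4 * suc n + (2 * suc (m * k) + suc (m * m))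
  length-callerArrays = begin
    sum (map length callerArrays)
      ≡⟨ cong₂ _+_ (length-byLabel (label ∘ part))
        (cong₂ _+_ (length-byLabel (λ g → k * toℕ (coset g)))
        (cong₂ _+_ (length-byLabel (λ g → m * toℕ (coset g)))
        (cong₂ _+_ (length-byLabel (label ∘ coset))
        (cong₂ _+_ (length-grid (λ j h → label (swap j h)))
        (cong₂ _+_ (length-grid (λ i j → label (times i j)))
        (cong₂ _+_ (length-grid (λ i h → label (join i h))) (refl {x = 0}))))))) ⟩
    suc n + (suc n + (suc n + (suc n + (suc (m * k) + (suc (m * m) + (suc (m * k) + 0))))))
      ≡⟨ solve 3 (λ a b c → a :+ (a :+ (a :+ (a :+ (b :+ (c :+ (b :+ con 0)))))) :=
                            con 4 :* a :+ (con 2 :* b :+ c)) refl (suc n) (suc (m * k)) (suc (m * m)) ⟩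
    4 * suc n + (2 * suc (m * k) + suc (m * m)) ∎
    where
    open ≡-Reasoning
    open +-*-Solver

  -- 34 = 21 instructions + 7 dummy cells + 4 tables of size n + 2 of size m k ≤ n.
  extended-space : 0 < n → m * k ≤ n → DataStructure.space extended ≤ space + 34 * (m ^ 2 + n)
  extended-space 0<n m*k≤n = begin
    21 + length (map relocate program) + sum (map length (callerArrays ++ arrays))
      ≡⟨ cong₂ (λ p q → 21 + p + q) (length-map relocate program) sum-arrays ⟩
    21 + length program + (4 * suc n + (2 * suc (m * k) + suc (m * m)) + a)
      ≡⟨ solve 5 (λ p n mk m a →
           con 21 :+ p :+ (con 4 :* (con 1 :+ n) :+ (con 2 :* (con 1 :+ mk) :+ (con 1 :+ m :* m)) :+ a) :=
           p :+ a :+ (con 28 :* con 1 :+ con 4 :* n :+ con 2 :* mk :+ m :* m)) refl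
           (length program) n (m * k) m a ⟩
    space + (28 * 1 + 4 * n + 2 * (m * k) + m * m)
      -- The 28 constant words are charged to `n`, which is at least 1.
      ≤⟨ ℕ.+-monoʳ-≤ space (ℕ.+-mono-≤ (ℕ.+-mono-≤ (ℕ.+-monoˡ-≤ (4 * n) (ℕ.*-monoʳ-≤ 28 0<n))
           (ℕ.*-monoʳ-≤ 2 m*k≤n)) (ℕ.m≤n*m (m * m) 34)) ⟩
    space + (28 * n + 4 * n + 2 * n + 34 * (m * m))
      ≡⟨ cong (space +_) (solve 2 (λ n m →
           con 28 :* n :+ con 4 :* n :+ con 2 :* n :+ con 34 :* (m :* m) :=
           con 34 :* (m :* (m :* con 1) :+ n)) refl n m) ⟩
    space + 34 * (m ^ 2 + n) ∎
    where
    open ℕ.≤-Reasoning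
    open +-*-Solver
    a = sum (map length arrays)
    sum-arrays : sum (map length (callerArrays ++ arrays)) ≡
      4 * suc n + (2 * suc (m * k) + suc (m * m)) + a
    sum-arrays = trans (cong sum (map-++ length callerArrays arrays))
      (trans (sum-++ (map length callerArrays) (map length arrays)) (cong (_+ a) length-callerArrays))

  module _ {W : ℕ} (n<W : n < W) (m*k<W : m * k < W) (m*m<W : m * m < W) where

    0<W : 0 < W
    0<W = ℕ.≤-<-trans z≤n n<W

    callerArrays-words : k ≤ n → m ≤ n → All (All (_< W)) callerArrays
    callerArrays-words k≤n m≤n =
      byLabel-All 0<W (λ g → ℕ.≤-<-trans (ℕ.≤-trans (label≤ (part g)) k≤n) n<W) ∷
      byLabel-All 0<W (λ g → ℕ.≤-<-trans (grid-row≤ (coset g)) m*k<W) ∷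
      byLabel-All 0<W (λ g → ℕ.≤-<-trans (grid-row≤ (coset g)) m*m<W) ∷
      byLabel-All 0<W (λ g → ℕ.≤-<-trans (ℕ.≤-trans (label≤ (coset g)) m≤n) n<W) ∷
      byLabel-All 0<W (λ _ → label<W _) ∷
      byLabel-All 0<W (λ _ → label<W _) ∷
      byLabel-All 0<W (λ _ → label<W _) ∷
      []
      where
      label<W : (g : Fin n) → label g < W
      label<W g = ℕ.≤-<-trans (label≤ g) n<W

    module M′ = Machine W extended
    open Steps W extended

    module _ {W₀} (W₀≤W : W₀ ≤ W) where
      module M = Machine W₀ D
      open Subroutine W₀≤W D extended (λ p → map-‼ relocate program p) (λ A eq → eq)

      -- The caller spends 14 steps up to the first call, 4 between the calls and 4 after the
      -- second.
      run : ∀ g₁ g₂ {k₁ k₂} →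
        let x = swap (coset g₂) (part g₁)
            y = times (coset g₁) (coset x)
        in ∀ {h h′ : Fin k} →
        M.query (label (part y)) (label (part x)) M.⇓ label h at k₁ →
        M.query (label h) (label (part g₂)) M.⇓ label h′ at k₂ →
        M′.query (label g₁) (label g₂) M′.⇓ label (join (coset y) h′) at (14 + (k₁ + (4 + (k₂ + 4))))
      run g₁ g₂ {h = h} {h′} run₁ run₂ =
        step-read refl refl refl (byLabel-‼ (label ∘ part) g₁) then
        step-read refl refl refl (byLabel-‼ (λ g → m * toℕ (coset g)) g₁) then
        step-read refl refl refl (byLabel-‼ (label ∘ part) g₂) then
        step-read refl refl refl (byLabel-‼ (λ g → k * toℕ (coset g)) g₂) then
        step-op refl refl refl refl (ℕ.≤-<-trans (grid-index≤ (coset g₂) (part g₁)) m*k<W) then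
        step-read refl refl refl (grid-‼ (λ j h → label (swap j h)) (coset g₂) (part g₁)) then
        step-read refl refl refl (byLabel-‼ (label ∘ coset) x) then
        step-op refl refl refl refl (ℕ.≤-<-trans (grid-index≤ (coset g₁) (coset x)) m*m<W) then
        step-read refl refl refl (grid-‼ (λ i j → label (times i j)) (coset g₁) (coset x)) then
        step-read refl refl refl (byLabel-‼ (λ g → k * toℕ (coset g)) y) then
        step-read refl refl refl (byLabel-‼ (label ∘ part) y) then
        step-read refl refl refl (byLabel-‼ (label ∘ part) x) then
        step-const refl 0<W then
        step-jump refl then
        call run₁ refl refl (λ R _ R≈ R₇ →
          step-jumpIf false refl (R≈ 6 _) (R≈ 4 _) refl then
          step-move refl (R≈ 4 _) then
          step-move refl (R≈ 4 _) then
          step-jump refl then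
          -- The first result is already in register `#registers`, where the second call expects its
          -- first argument.
          call run₂ R₇ refl (λ R′ _ R′≈ R₇′ →
            step-jumpIf true refl (R′≈ 6 _) (trans (R′≈ 4 _) (R≈ 4 _))
              (Equivalence.to Bool.T-≡ (ℕ.≡⇒≡ᵇ (label (part g₂)) _ refl)) then
            step-op refl (trans (R′≈ 2 _) (R≈ 2 _)) R₇′ refl
              (ℕ.≤-<-trans (grid-index≤ (coset y) h′) m*k<W) then
            step-read refl refl refl (grid-‼ (λ i h → label (join i h)) (coset y) h′) then
            M′.done refl))
        where
        x = swap (coset g₂) (part g₁)
        y = times (coset g₁) (coset x)

-- Correctness and rational bounds for the extended structure

module Extension {κ : ℕ} (2≤κ : 2 ≤ κ) {G : FiniteGroup} {H : Subgroup G} (L : Labelling H)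
  {s t : ℚ} (hds : HasDataStructure κ (Labelling.group L) s t) where
  open FiniteGroup G
  open IsGroup isGroup using (assoc)
  open Subgroup H using (index)
  open Cosets L
  private
    module S = HasDataStructure hds

  swap : Fin index → Fin K.order → Fin order
  swap j h = embed h ∙ rep j

  times : Fin index → Fin index → Fin order
  times i j = rep i ∙ rep j

  join : Fin index → Fin K.order → Fin order
  join i h = rep i ∙ embed h

  -- Reassociation exposes in turn the factorisations of `y`, of `x`, and of `g₁` and `g₂`;
  -- `rep∙part` contracts each of them.
  factorisation : ∀ g₁ g₂ →
    let x = swap (coset g₂) (part g₁)
        y = times (coset g₁) (coset x)
    in join (coset y) ((part y K.∙ part x) K.∙ part g₂) ≡ g₁ ∙ g₂
  factorisation g₁ g₂ = begin
    rep (coset y) ∙ embed ((part y K.∙ part x) K.∙ part g₂)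
      ≡⟨ cong (rep (coset y) ∙_) (trans (embed-homo _ _) (cong (_∙ h₂) (embed-homo _ _))) ⟩
    rep (coset y) ∙ (embed (part y) ∙ embed (part x) ∙ h₂)
      ≡⟨ trans (cong (_∙ h₂) (assoc _ _ _)) (assoc _ _ _) ⟨
    rep (coset y) ∙ embed (part y) ∙ embed (part x) ∙ h₂
      ≡⟨ cong (λ z → z ∙ embed (part x) ∙ h₂) (rep∙part y) ⟩
    r₁ ∙ rep (coset x) ∙ embed (part x) ∙ h₂
      ≡⟨ cong (_∙ h₂) (trans (assoc _ _ _) (cong (r₁ ∙_) (rep∙part x))) ⟩
    r₁ ∙ (h₁ ∙ r₂) ∙ h₂
      ≡⟨ trans (cong (_∙ h₂) (sym (assoc _ _ _))) (assoc _ _ _) ⟩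
    r₁ ∙ h₁ ∙ (r₂ ∙ h₂)
      ≡⟨ cong₂ _∙_ (rep∙part g₁) (rep∙part g₂) ⟩
    g₁ ∙ g₂ ∎
    where
    open ≡-Reasoning
    r₁ = rep (coset g₁)
    r₂ = rep (coset g₂)
    h₁ = embed (part g₁)
    h₂ = embed (part g₂)
    x  = swap (coset g₂) (part g₁)
    y  = times (coset g₁) (coset x)

  open Caller coset part swap times join S.structure

  0<order : 0 < order
  0<order = ℕ.≤-<-trans z≤n (toℕ<n ε)

  order≤order² : order ≤ order * order
  order≤order² = ℕ.m≤m*n order order {{>-nonZero 0<order}}

  index≤order : index ≤ order
  index≤order = ℕ.≤-trans (ℕ.m≤m*n index K.order {{>-nonZero (ℕ.≤-<-trans z≤n (toℕ<n K.ε))}}) index*order≤order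

  K≤order : K.order ≤ order
  K≤order = injective⇒≤ embed-injective

  ≤order²⇒< : ∀ {x} → x ≤ order * order → x < wordBound κ order
  ≤order²⇒< x≤ = ℕ.≤-<-trans x≤ (n*n<wordBound 2≤κ order)

  order<W : order < wordBound κ order
  order<W = ≤order²⇒< order≤order²

  index*order<W : index * K.order < wordBound κ order
  index*order<W = ≤order²⇒< (ℕ.≤-trans index*order≤order order≤order²)

  index²<W : index * index < wordBound κ order
  index²<W = ≤order²⇒< (ℕ.*-mono-≤ index≤order index≤order)

  space-bound : fromℕ (DataStructure.space extended) ℚ.≤ s ℚ.+ fromℕ 34 ℚ.* fromℕ (index ^ 2 + order)
  space-bound = begin
    fromℕ (DataStructure.space extended)
      ≤⟨ fromℕ-mono-≤ (extended-space 0<order index*order≤order) ⟩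
    fromℕ (S.space + 34 * (index ^ 2 + order))
      ≡⟨ trans (fromℕ-homo-+ S.space (34 * (index ^ 2 + order)))
               (cong (fromℕ S.space ℚ.+_) (fromℕ-homo-* 34 (index ^ 2 + order))) ⟩
    fromℕ S.space ℚ.+ fromℕ 34 ℚ.* fromℕ (index ^ 2 + order)
      ≤⟨ ℚ.+-monoˡ-≤ _ S.space≤s ⟩
    s ℚ.+ fromℕ 34 ℚ.* fromℕ (index ^ 2 + order) ∎
    where open ℚ.≤-Reasoning

  time-bound : ∀ k₁ k₂ → fromℕ k₁ ℚ.≤ t → fromℕ k₂ ℚ.≤ t →
    fromℕ (14 + (k₁ + (4 + (k₂ + 4)))) ℚ.≤ fromℕ 2 ℚ.* t ℚ.+ fromℕ 22
  time-bound k₁ k₂ k₁≤t k₂≤t = begin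
    fromℕ (14 + (k₁ + (4 + (k₂ + 4))))
      ≡⟨ cong fromℕ (solve 2 (λ a b → con 14 :+ (a :+ (con 4 :+ (b :+ con 4))) := a :+ b :+ con 22) refl k₁ k₂) ⟩
    fromℕ (k₁ + k₂ + 22)
      ≡⟨ trans (fromℕ-homo-+ (k₁ + k₂) 22) (cong (ℚ._+ fromℕ 22) (fromℕ-homo-+ k₁ k₂)) ⟩
    fromℕ k₁ ℚ.+ fromℕ k₂ ℚ.+ fromℕ 22
      ≤⟨ ℚ.+-monoˡ-≤ (fromℕ 22) (ℚ.+-mono-≤ k₁≤t k₂≤t) ⟩
    t ℚ.+ t ℚ.+ fromℕ 22
      ≡⟨ cong (ℚ._+ fromℕ 22) (cong₂ ℚ._+_ (ℚ.*-identityˡ t) (ℚ.*-identityˡ t)) ⟨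
    ℚ.1ℚ ℚ.* t ℚ.+ ℚ.1ℚ ℚ.* t ℚ.+ fromℕ 22
      -- The closed rationals `fromℕ 2` and 1 + 1 agree by computation.
      ≡⟨ cong (ℚ._+ fromℕ 22) (ℚ.*-distribʳ-+ t ℚ.1ℚ ℚ.1ℚ) ⟨
    fromℕ 2 ℚ.* t ℚ.+ fromℕ 22 ∎
    where
    open ℚ.≤-Reasoning
    open +-*-Solver

  hasDataStructure : HasDataStructure κ G
    (s ℚ.+ fromℕ 34 ℚ.* fromℕ (index ^ 2 + order)) (fromℕ 2 ℚ.* t ℚ.+ fromℕ 22)
  hasDataStructure = record
    { structure = extended
    ; words     = ++⁺ (callerArrays-words order<W index*order<W index²<W K≤order index≤order)
                      (All.map (All.map (λ v<W → ℕ.<-≤-trans v<W (wordBound-mono κ K≤order))) S.words)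
    ; space≤s   = space-bound
    ; answers   = answer
    }
    where
    open Machine (wordBound κ order) extended using (query; _⇓_at_)
    answer : ∀ g₁ g₂ → ∃[ k ] fromℕ k ℚ.≤ fromℕ 2 ℚ.* t ℚ.+ fromℕ 22 ×
      (query (label g₁) (label g₂) ⇓ label (g₁ ∙ g₂) at k)
    answer g₁ g₂ =
      let x = swap (coset g₂) (part g₁)
          y = times (coset g₁) (coset x)
          k₁ , k₁≤t , run₁ = S.answers (part y) (part x)
          k₂ , k₂≤t , run₂ = S.answers (part y K.∙ part x) (part g₂)
      in _ , time-bound k₁ k₂ k₁≤t k₂≤t ,
         subst (λ g → query (label g₁) (label g₂) ⇓ label g at (14 + (k₁ + (4 + (k₂ + 4))))) (factorisation g₁ g₂)
           (run order<W index*order<W index²<W (wordBound-mono κ K≤order) g₁ g₂ run₁ run₂)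

theorem3 : ∀ (κ : ℕ) → 2 ≤ κ →
    ∃₂ λ (c d : ℚ) → Positive c × Positive d ×
    (∀ (G : FiniteGroup) (H : Subgroup G) (L : Labelling H)
    (s t : ℚ) → Positive s → Positive t →
    HasDataStructure κ (Labelling.group L) s t →
    HasDataStructure κ G
    (s ℚ.+ c ℚ.* fromℕ (Subgroup.index H ^ 2 + FiniteGroup.order G))
    (fromℕ 2 ℚ.* t ℚ.+ d))
-- The constant 34 comes from `extended-space`, and 22 = 14 + 4 + 4 counts the caller's own steps.
theorem3 κ 2≤κ = fromℕ 34 , fromℕ 22 , _ , _ ,
  λ G H L s t _ _ hds → Extension.hasDataStructure 2≤κ L hds
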